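{- Let $a,b$ be relatively prime positive integers such that $a$ is even and $b>2a$ (so $b$ is odd). Then the sequence $\mathcal{V}(a,b)$ has at least $2+\lfloor a/4\rfloor$ even terms.
   Context: For positive integers $a<b$, the sequence $\mathcal{V}(a,b)=(a_m)_{m\geqslant 1}$ is defined greedily by $a_1=a$, $a_2=b$, and, for $m\geqslant 2$, $a_{m+1}$ is the smallest integer larger than $a_m$ that can be written as $a_i+a_j$ with $i\leqslant j\leqslant m$ (the two earlier terms not necessarily distinct) in exactly one way (representations are unordered pairs). -}

module Defs where

open import Data.Nat using (ℕ; zero; suc; _+_; _*_; _≡ᵇ_)
open import Data.Nat.Divisibility using (_∣?_)
open import Data.Bool using (if_then_else_)
open import Data.List using (List; []; _∷_; length; filter; map; upTo)

-- Number of unordered representations n = x_i + x_j with i ≤ j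
-- (indices into the list xs; order of the list is irrelevant).
countWith : ℕ → List ℕ → ℕ → ℕ
countWith x []       n = 0
countWith x (y ∷ ys) n = (if (x + y) ≡ᵇ n then 1 else 0) + countWith x ys n

reps : List ℕ → ℕ → ℕ
reps []       n = 0
reps (x ∷ xs) n = countWith x (x ∷ xs) n + reps xs n

search : List ℕ → ℕ → ℕ → ℕ
search xs n zero       = n
search xs n (suc fuel) = if reps xs n ≡ᵇ 1 then n else search xs (suc n) fuel

headOr0 : List ℕ → ℕ
headOr0 []      = 0
headOr0 (x ∷ _) = x

-- Next term, given the terms so far with the last (largest) term at the head.
-- Since 2 * last is always uniquely representable, searching the interval
-- (last, 2 * last] suffices; the fallback is never reached.
next : List ℕ → ℕ
next xs = search xs (suc (headOr0 xs)) (headOr0 xs)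

terms : ℕ → ℕ → ℕ → List ℕ
terms a b zero    = b ∷ a ∷ []
terms a b (suc m) = next (terms a b m) ∷ terms a b m

V : ℕ → ℕ → ℕ → ℕ
V a b zero          = a
V a b (suc zero)    = b
V a b (suc (suc m)) = next (terms a b m)

evenCount : ℕ → ℕ → ℕ → ℕ
evenCount a b N = length (filter (λ x → 2 ∣? x) (map (V a b) (upTo N)))

{-# OPTIONS --safe #-}
-- Up to a b + a, terms are written i b + j a with i ≤ a, essentially uniquely, so the
-- sequence is the image of a set of lattice points (i , j) built from (0 , 1) and (1 , 0) by
-- the same greedy rule. This set is explicit: its even rows hold (2 , 0) and (4 k , 1) only,
-- and its odd rows from row 7 on depend only on the row modulo 8. Every point of it other than
-- the two generators is a sum of two of its points in one way, and every other sum of two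
-- points, except (0 , 2), is one in several ways; the exception has value 2 a < b. The even
-- terms found are thus 2 b and 4 k b + a for k ≤ a / 4.
module Submission where

open import Defs
open import Data.Bool using (true; false) renaming (T to IsTrue)
open import Data.Empty using (⊥-elim)
open import Data.Fin using (Fin; zero; suc; toℕ)
open import Data.Fin.Properties using (injective⇒≤; toℕ<n; toℕ-injective)
open import Data.List using (List; []; _∷_; length; lookup; map; upTo)
open import Data.List.Membership.Propositional using (_∈_)
open import Data.List.Membership.Propositional.Properties using (∈-filter⁺; ∈-map⁺; ∈-upTo⁺)
open import Data.List.Relation.Unary.All as All using ([]; _∷_)
open import Data.List.Relation.Unary.AllPairs using ([]; _∷_)
open import Data.List.Relation.Unary.Any using (here; there)
open import Data.List.Relation.Unary.Any.Properties using (lookup-index)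
open import Data.List.Relation.Unary.Unique.Propositional using (Unique)
open import Data.Nat using (ℕ; zero; suc; _+_; _*_; _<_; _≤_; _/_; _%_; _∸_; _≟_; _≤?_; _≡ᵇ_; z≤n; s≤s; NonZero; >-nonZero)
open import Data.Nat.Coprimality using (Coprime; coprime-divisor)
open import Data.Nat.DivMod using ([m+kn]%n≡m%n; m<n⇒m%n≡m; m/n*n≤m)
open import Data.Nat.Divisibility using (_∣_; _∣?_; divides; _∣0; ∣⇒≤; n∣m*n; m∣m*n; ∣m⇒∣m*n; ∣n⇒∣m*n; ∣m∣n⇒∣m+n; ∣m+n∣m⇒∣n)
open import Data.Nat.Properties
open import Data.Nat.Tactic.RingSolver using (solve-∀)
open import Data.Product using (∃-syntax; _×_; _,_; proj₁; proj₂)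
open import Data.Sum using (_⊎_; inj₁; inj₂; swap)
open import Relation.Binary.PropositionalEquality
open import Relation.Nullary using (¬_; yes; no; contradiction)

-- Counting representations in a list

countWith-witness : ∀ x ys n → countWith x ys n ≢ 0 → ∃[ y ] y ∈ ys × x + y ≡ n
countWith-witness x [] n ≢0 = contradiction refl ≢0
countWith-witness x (y ∷ ys) n ≢0 with x + y ≡ᵇ n in eq
... | true  = y , here refl , ≡ᵇ⇒≡ _ _ (subst IsTrue (sym eq) _)
... | false = let z , z∈ , p = countWith-witness x ys n ≢0 in z , there z∈ , p

countWith-positive : ∀ {x y ys n} → y ∈ ys → x + y ≡ n → 1 ≤ countWith x ys n
countWith-positive {x} {y} {z ∷ ys} {n} (here refl) p with x + y ≡ᵇ n in eq
... | true  = s≤s z≤n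
... | false = ⊥-elim (subst IsTrue eq (≡⇒≡ᵇ _ _ p))
countWith-positive {x} {y} {z ∷ ys} {n} (there y∈) p =
  ≤-trans (countWith-positive y∈ p) (m≤n+m _ _)

countWith-zero : ∀ {x ys n} → (∀ {y} → y ∈ ys → x + y ≢ n) → countWith x ys n ≡ 0
countWith-zero {x} {ys} {n} none with countWith x ys n ≟ 0
... | yes p = p
... | no ≢0 = let y , y∈ , p = countWith-witness x ys n ≢0 in contradiction p (none y∈)

countWith≤1 : ∀ {x ys} n → Unique ys → countWith x ys n ≤ 1
countWith≤1 {x} {[]} n [] = z≤n
countWith≤1 {x} {y ∷ ys} n (y∉ ∷ u) with x + y ≡ᵇ n in eq
... | false = countWith≤1 n u
... | true  = s≤s (≤-reflexive (countWith-zero λ z∈ p →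
        All.lookup y∉ z∈ (+-cancelˡ-≡ x _ _ (trans (≡ᵇ⇒≡ _ _ (subst IsTrue (sym eq) _)) (sym p)))))

reps-witness : ∀ xs n → reps xs n ≢ 0 → ∃[ x ] ∃[ y ] x ∈ xs × y ∈ xs × x + y ≡ n
reps-witness [] n ≢0 = contradiction refl ≢0
reps-witness (z ∷ zs) n ≢0 with countWith z (z ∷ zs) n ≟ 0
... | no c≢0 = let y , y∈ , p = countWith-witness z (z ∷ zs) n c≢0 in z , y , here refl , y∈ , p
... | yes c≡0 =
  let x , y , x∈ , y∈ , p = reps-witness zs n (λ r≡0 → ≢0 (cong₂ _+_ c≡0 r≡0))
  in x , y , there x∈ , there y∈ , p

reps-positive : ∀ {x y xs n} → x ∈ xs → y ∈ xs → x + y ≡ n → 1 ≤ reps xs n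
reps-positive (here refl) y∈ p = ≤-trans (countWith-positive y∈ p) (m≤m+n _ _)
reps-positive {x} {y} (there x∈) (here refl) p =
  ≤-trans (countWith-positive (there x∈) (trans (+-comm y x) p)) (m≤m+n _ _)
reps-positive {xs = z ∷ zs} {n} (there x∈) (there y∈) p =
  ≤-trans (reps-positive x∈ y∈ p) (m≤n+m _ (countWith z (z ∷ zs) n))

meetsHead : ∀ {x y z : ℕ} {zs} → x ∈ z ∷ zs → y ∈ z ∷ zs →
  (x ≡ z ⊎ y ≡ z) ⊎ (x ∈ zs × y ∈ zs)
meetsHead (here p) _ = inj₁ (inj₁ p)
meetsHead (there _) (here p) = inj₁ (inj₂ p)
meetsHead (there p) (there q) = inj₂ (p , q)

countHead-positive : ∀ {x y z zs n} → x ∈ z ∷ zs → y ∈ z ∷ zs → x + y ≡ n →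
  x ≡ z ⊎ y ≡ z → 1 ≤ countWith z (z ∷ zs) n
countHead-positive x∈ y∈ p (inj₁ refl) = countWith-positive y∈ p
countHead-positive {x} {y} x∈ y∈ p (inj₂ refl) = countWith-positive x∈ (trans (+-comm y x) p)

-- Cancelling the shared `z` makes the two pairs the same unordered pair, so different
-- representations cannot both use the head of a list.
sum-meets : ∀ {x y x′ y′ z} → x + y ≡ x′ + y′ → x ≡ z ⊎ y ≡ z → x′ ≡ z ⊎ y′ ≡ z → x ≡ x′ ⊎ x ≡ y′
sum-meets p (inj₁ refl) (inj₁ refl) = inj₁ refl
sum-meets p (inj₁ refl) (inj₂ refl) = inj₂ refl
sum-meets {x} {y} {x′} {y′} p (inj₂ refl) (inj₁ refl) =
  inj₂ (+-cancelʳ-≡ y x y′ (trans p (+-comm y y′)))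
sum-meets {x} {y} {x′} {y′} p (inj₂ refl) (inj₂ refl) = inj₁ (+-cancelʳ-≡ y x x′ p)

-- By `sum-meets` at most one of the two pairs meets the head. If one does, the head counts it and
-- the tail counts the other; otherwise both lie in the tail.
reps-two : ∀ {x y x′ y′ xs n} → x ∈ xs → y ∈ xs → x′ ∈ xs → y′ ∈ xs →
  x + y ≡ n → x′ + y′ ≡ n → x ≢ x′ → x ≢ y′ → 2 ≤ reps xs n
reps-two {xs = z ∷ zs} {n} x∈ y∈ x′∈ y′∈ p p′ x≢x′ x≢y′
  with meetsHead x∈ y∈ | meetsHead x′∈ y′∈
... | inj₁ m | inj₁ m′ with sum-meets (trans p (sym p′)) m m′
...   | inj₁ q = contradiction q x≢x′
...   | inj₂ q = contradiction q x≢y′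
reps-two x∈ y∈ x′∈ y′∈ p p′ x≢x′ x≢y′ | inj₁ m | inj₂ (u , v) =
  +-mono-≤ (countHead-positive x∈ y∈ p m) (reps-positive u v p′)
reps-two x∈ y∈ x′∈ y′∈ p p′ x≢x′ x≢y′ | inj₂ (u , v) | inj₁ m =
  +-mono-≤ (countHead-positive x′∈ y′∈ p′ m) (reps-positive u v p)
reps-two {xs = z ∷ zs} {n} x∈ y∈ x′∈ y′∈ p p′ x≢x′ x≢y′ | inj₂ (u , v) | inj₂ (u′ , v′) =
  ≤-trans (reps-two u v u′ v′ p p′ x≢x′ x≢y′) (m≤n+m _ (countWith z (z ∷ zs) n))

-- Uniqueness enters as one summand `c` common to all representations. If head count and tail count
-- were both positive, `sum-meets` would put the head `z` among `zs`.
reps≤1 : ∀ {xs n} → Unique xs →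
  (c : ℕ) → (∀ {x y} → x ∈ xs → y ∈ xs → x + y ≡ n → x ≡ c ⊎ y ≡ c) → reps xs n ≤ 1
reps≤1 {[]} _ c only = z≤n
reps≤1 {z ∷ zs} {n} (z∉ ∷ u) c only with countWith z (z ∷ zs) n ≟ 0
... | yes q rewrite q = reps≤1 u c (λ x∈ y∈ → only (there x∈) (there y∈))
... | no ≢0 with reps zs n ≟ 0
...   | yes r rewrite r | +-identityʳ (countWith z (z ∷ zs) n) = countWith≤1 n (z∉ ∷ u)
...   | no r≢0 with countWith-witness z (z ∷ zs) n ≢0 | reps-witness zs n r≢0
...     | w , w∈ , p | x , y , x∈ , y∈ , p′
        with sum-meets (trans p (sym p′)) (only (here refl) w∈ p) (only (there x∈) (there y∈) p′)
...       | inj₁ q = contradiction q (All.lookup z∉ x∈)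
...       | inj₂ q = contradiction q (All.lookup z∉ y∈)

search-least : ∀ {xs n} s f → s ≤ n → n ≤ s + f →
  (∀ {k} → s ≤ k → k < n → reps xs k ≢ 1) → reps xs n ≡ 1 → search xs s f ≡ n
-- Out of fuel, `search` returns its start `s`, which the bounds force to be `n`.
search-least s zero s≤n n≤ gap r = ≤-antisym s≤n (subst (_ ≤_) (+-identityʳ s) n≤)
search-least {xs} {n} s (suc f) s≤n n≤ gap r with reps xs s ≡ᵇ 1 in eq
... | true with m≤n⇒m<n∨m≡n s≤n
...   | inj₁ s<n = contradiction (≡ᵇ⇒≡ _ _ (subst IsTrue (sym eq) _)) (gap ≤-refl s<n)
...   | inj₂ s≡n = s≡n
search-least {xs} {n} s (suc f) s≤n n≤ gap r | false =
  search-least (suc s) f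
    (≤∧≢⇒< s≤n λ { refl → subst IsTrue eq (≡⇒≡ᵇ _ _ r) })
    (subst (n ≤_) (+-suc s f) n≤) (λ s<k → gap (<⇒≤ s<k)) r

-- The set of lattice points

data Even : ℕ → Set
data Odd : ℕ → Set
data Even where
  zero : Even 0
  suc  : ∀ {n} → Odd n → Even (suc n)
data Odd where
  suc  : ∀ {n} → Even n → Odd (suc n)

even⊎odd : ∀ n → Even n ⊎ Odd n
even⊎odd zero = inj₁ zero
even⊎odd (suc n) with even⊎odd n
... | inj₁ e = inj₂ (suc e)
... | inj₂ o = inj₁ (suc o)

even∧odd : ∀ {n} → Even n → ¬ Odd n
even∧odd (suc o) (suc e) = even∧odd e o

-- InA t j and InB t j say that (1 + 4 t) b + j a and (3 + 4 t) b + j a are odd terms.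
data InA : ℕ → ℕ → Set where
  full : ∀ {j} → InA 0 j
  base : ∀ {t} → InA t 0
  five : InA 1 3
  two  : ∀ {t} → Even t → InA (2 + t) 2
  tail : ∀ {t j} → Odd j → InA (suc t) (4 + j)

data InB : ℕ → ℕ → Set where
  full : ∀ {j} → Even j → InB 0 j
  base : ∀ {t} → InB t 0
  two  : ∀ {t} → Even t → InB (2 + t) 2

-- The terms: E k is 4 k b + a, T is 2 b.
data Point : Set where
  E : ℕ → Point
  T : Point
  A : ∀ {t j} → InA t j → Point
  B : ∀ {t j} → InB t j → Point

row col : Point → ℕ
row (E k)     = k * 4
row T         = 2
row (A {t} _) = 1 + t * 4
row (B {t} _) = 3 + t * 4
col (E k)         = 1
col T             = 0
col (A {_} {j} _) = j
col (B {_} {j} _) = j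

At : Point → ℕ → ℕ → Set
At p i j = row p ≡ i × col p ≡ j

-- Positions are compared rather than points, because points carry proofs: (1 , 0) comes with both
-- `full` and `base`.
SameAs : Point → Point → Set
SameAs p q = At p (row q) (col q)

record Rep (i j : ℕ) : Set where
  constructor rep
  field
    left right : Point
    row-sum    : row left + row right ≡ i
    col-sum    : col left + col right ≡ j
open Rep public

record Two (i j : ℕ) : Set where
  constructor twice
  field
    rep₁ rep₂ : Rep i j
    left≢left  : ¬ SameAs (left rep₁) (left rep₂)
    left≢right : ¬ SameAs (left rep₁) (right rep₂)

-- Classification of lattice positions by row modulo 4

B⇒even : ∀ {t j} → InB t j → Even j
B⇒even (full e) = e
B⇒even base     = zero
B⇒even (two _)  = suc (suc zero)

-- Supplies the one representation of a B point: `T` plus the A point two rows lower in the same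
-- column.
B⇒A : ∀ {t j} → InB t j → InA t j
B⇒A (full _) = full
B⇒A base     = base
B⇒A (two e)  = two e

-- In row 5, `five` extends the tail down to column 3. This row then provides the second
-- representation of many positions in higher rows.
five-tail : ∀ {j} → Even j → InA 1 (3 + j)
five-tail zero    = five
five-tail (suc o) = tail o

-- Column 2 alternates: (1 , 1) plus an E point always works, and a second sum, `T` plus a B point,
-- exists exactly when the row two lower has a point in column 2. In even columns from 4 on, E
-- points pair with row 1 and with row 5.
classA : ∀ t j → InA t j ⊎ Two (1 + t * 4) j
classA 0 j = inj₁ full
classA (suc t) 0 = inj₁ base
classA (suc t) 1 = inj₂ (twice
  (rep (E 0) (A {suc t} base) refl refl) (rep (E 1) (A {t} base) refl refl) (λ ()) (λ ()))
classA 1 2 = inj₂ (twice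
  (rep T (B {0} (full (suc (suc zero)))) refl refl) (rep (E 1) (A {0} {1} full) refl refl)
  (λ ()) (λ ()))
classA (suc (suc t)) 2 with even⊎odd t
... | inj₁ e = inj₁ (two e)
... | inj₂ (suc e) = inj₂ (twice
  (rep T (B (two e)) refl refl) (rep (A {0} {1} full) (E (2 + t)) refl refl)
  (λ ()) (λ ()))
classA 1 3 = inj₁ five
classA (suc (suc t)) 3 = inj₂ (twice
  (rep (A {0} {2} full) (E (2 + t)) refl refl) (rep (A (two zero)) (E t) refl refl)
  (λ ()) (λ { (_ , ()) }))
classA (suc t) (suc (suc (suc (suc j)))) with even⊎odd j
... | inj₂ o = inj₁ (tail o)
... | inj₁ e = inj₂ (twice
  (rep (A {0} {3 + j} full) (E (suc t)) refl (+-comm (3 + j) 1))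
  (rep (A (five-tail e)) (E t) refl (+-comm (3 + j) 1))
  (λ ()) (λ { (_ , ()) }))

-- The third alternative is a position without representation: in an even column the only candidate
-- is `T` plus an A point, and that A point is absent.
classB : ∀ t j → InB t j ⊎ Two (3 + t * 4) j ⊎ Even j × ¬ InA t j
classB 0 j with even⊎odd j
... | inj₁ e = inj₁ (full e)
... | inj₂ (suc e) = inj₂ (inj₁ (twice
  (rep (E 0) (B {0} (full e)) refl refl) (rep T (A {0} {j} full) refl refl) (λ ()) (λ ())))
classB (suc t) 0 = inj₁ base
classB (suc t) 1 = inj₂ (inj₁ (twice
  (rep (E 0) (B {suc t} base) refl refl) (rep (E 1) (B {t} base) refl refl) (λ ()) (λ ())))
classB 1 2 = inj₂ (inj₂ (suc (suc zero) , λ ()))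
classB (suc (suc t)) 2 with even⊎odd t
... | inj₁ e = inj₁ (two e)
... | inj₂ o = inj₂ (inj₂ (suc (suc zero) , λ { (two e) → even∧odd e o }))
classB 1 3 = inj₂ (inj₁ (twice
  (rep (E 1) (B {0} (full (suc (suc zero)))) refl refl) (rep T (A five) refl refl)
  (λ ()) (λ ())))
classB (suc (suc t)) 3 = inj₂ (inj₁ (twice
  (rep (B {0} (full (suc (suc zero)))) (E (2 + t)) refl refl) (rep (B (two zero)) (E t) refl refl)
  (λ ()) (λ { (_ , ()) })))
classB (suc t) (suc (suc (suc (suc j)))) with even⊎odd j
... | inj₁ e = inj₂ (inj₂ (suc (suc (suc (suc e))) , λ { (tail o) → even∧odd e o }))
... | inj₂ o = inj₂ (inj₁ (twice
  (rep T (A {suc t} (tail o)) refl refl)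
  (rep (B {0} (full (suc (suc (suc o))))) (E (suc t)) refl (+-comm (3 + j) 1))
  (λ ()) (λ { (_ , ()) })))

class₂ : ∀ t j → (t ≡ 0 × j ≡ 0) ⊎ Two (2 + t * 4) j
class₂ 0 0 = inj₁ (refl , refl)
class₂ (suc t) 0 = inj₂ (twice
  (rep (A {0} {0} full) (A {suc t} base) refl refl)
  (rep (B {0} base) (B {t} base) refl refl) (λ ()) (λ ()))
class₂ t 1 = inj₂ (twice
  (rep T (E t) refl refl) (rep (A {0} {1} full) (A {t} base) refl refl)
  (λ ()) (separate t))
  where
  separate : ∀ t → ¬ SameAs T (A {t} base)
  -- Splitting `t` shows the row of the A point to be 1, or at least 5, and so never 2.
  separate zero    (() , _)
  separate (suc t) (() , _)
class₂ 0 (suc (suc j)) = inj₂ (twice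
  (rep (A {0} {0} full) (A {0} full) refl refl) (rep (A {0} {1} full) (A {0} full) refl refl)
  (λ ()) (λ ()))
class₂ (suc t) (suc (suc j)) with even⊎odd j
... | inj₁ e = inj₂ (twice
  (rep (A {0} full) (A {suc t} base) refl (+-identityʳ _))
  (rep (B {0} (full (suc (suc e)))) (B {t} base) refl (+-identityʳ _)) (λ ()) (λ ()))
... | inj₂ (suc e) = inj₂ (twice
  (rep (A {0} full) (A {suc t} base) refl (+-identityʳ _))
  (rep (A (five-tail e)) (A {t} base) refl (+-identityʳ _)) (λ ()) (λ { (_ , ()) }))

class₀ : ∀ t j → j ≡ 1 ⊎ Two (4 + t * 4) j
class₀ t 1 = inj₁ refl
class₀ 0 0 = inj₂ (twice (rep T T refl refl) (rep (A {0} {0} full) (B {0} base) refl refl) (λ ()) (λ ()))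
class₀ (suc t) 0 = inj₂ (twice
  (rep (A {0} {0} full) (B {suc t} base) refl refl)
  (rep (B {0} base) (A {suc t} base) refl refl) (λ ()) (λ ()))
class₀ t (suc (suc j)) with even⊎odd j
... | inj₁ e = inj₂ (twice
  (rep (A {0} full) (B {t} base) refl (+-identityʳ _))
  (rep (B {0} (full (suc (suc e)))) (A {t} base) refl (+-identityʳ _)) (λ ()) (λ { (_ , ()) }))
class₀ 0 (suc (suc (suc j))) | inj₂ (suc e) = inj₂ (twice
  (rep (A {0} full) (B {0} base) refl (+-identityʳ _))
  (rep (B {0} (full (suc (suc zero)))) (A {0} {suc j} full) refl refl)
  -- Both points are in row 1, but their columns differ by 2.
  (λ ()) (λ { (_ , p) → m≢1+n+m (suc j) {1} (sym p) }))
class₀ (suc t) (suc (suc (suc j))) | inj₂ (suc e) = inj₂ (twice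
  (rep (A {0} full) (B {suc t} base) refl (+-identityʳ _))
  (rep (A (five-tail e)) (B {t} base) refl (+-identityʳ _)) (λ ()) (λ ()))

-- Split ρ t j q r: q and r are in a fixed order, and q + r lies in row ρ + 4 t and column j.
data Split : ℕ → ℕ → ℕ → Point → Point → Set where
  EE : ∀ k l → Split 0 (k + l) 2 (E k) (E l)
  ET : ∀ k → Split 2 k 1 (E k) T
  TT : Split 0 1 0 T T
  EA : ∀ k {s j} (α : InA s j) → Split 1 (k + s) (suc j) (E k) (A α)
  EB : ∀ k {s j} (β : InB s j) → Split 3 (k + s) (suc j) (E k) (B β)
  TA : ∀ {s j} (α : InA s j) → Split 3 s j T (A α)
  TB : ∀ {s j} (β : InB s j) → Split 1 (suc s) j T (B β)
  AA : ∀ {s j t l} (α : InA s j) (α′ : InA t l) → Split 2 (s + t) (j + l) (A α) (A α′)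
  AB : ∀ {s j t l} (α : InA s j) (β : InB t l) → Split 0 (suc (s + t)) (j + l) (A α) (B β)
  BB : ∀ {s j t l} (β : InB s j) (β′ : InB t l) → Split 2 (suc (s + t)) (j + l) (B β) (B β′)

split-row : ∀ {ρ t j q r} → Split ρ t j q r → row q + row r ≡ ρ + t * 4
split-row (EE k l)             = sym (*-distribʳ-+ 4 k l)
split-row (ET k)               = +-comm (k * 4) 2
split-row TT                   = refl
split-row (EA k {s} α)         = lemma k s
  where lemma : ∀ k s → k * 4 + (1 + s * 4) ≡ 1 + (k + s) * 4
        lemma = solve-∀
split-row (EB k {s} β)         = lemma k s
  where lemma : ∀ k s → k * 4 + (3 + s * 4) ≡ 3 + (k + s) * 4
        lemma = solve-∀
split-row (TA α)               = refl
split-row (TB β)               = refl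
split-row (AA {s} {_} {t} _ _) = lemma s t
  where lemma : ∀ s t → 1 + s * 4 + (1 + t * 4) ≡ 2 + (s + t) * 4
        lemma = solve-∀
split-row (AB {s} {_} {t} _ _) = lemma s t
  where lemma : ∀ s t → 1 + s * 4 + (3 + t * 4) ≡ 4 + (s + t) * 4
        lemma = solve-∀
split-row (BB {s} {_} {t} _ _) = lemma s t
  where lemma : ∀ s t → 3 + s * 4 + (3 + t * 4) ≡ 6 + (s + t) * 4
        lemma = solve-∀

split-col : ∀ {ρ t j q r} → Split ρ t j q r → col q + col r ≡ j
split-col (EE _ _) = refl
split-col (ET _)   = refl
split-col TT       = refl
split-col (EA _ _) = refl
split-col (EB _ _) = refl
split-col (TA _)   = refl
split-col (TB _)   = refl
split-col (AA _ _) = refl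
split-col (AB _ _) = refl
split-col (BB _ _) = refl

split<4 : ∀ {ρ t j q r} → Split ρ t j q r → ρ < 4
split<4 (EE _ _) = s≤s z≤n
split<4 (ET _)   = s≤s (s≤s (s≤s z≤n))
split<4 TT       = s≤s z≤n
split<4 (EA _ _) = s≤s (s≤s z≤n)
split<4 (EB _ _) = s≤s (s≤s (s≤s (s≤s z≤n)))
split<4 (TA _)   = s≤s (s≤s (s≤s (s≤s z≤n)))
split<4 (TB _)   = s≤s (s≤s z≤n)
split<4 (AA _ _) = s≤s (s≤s (s≤s z≤n))
split<4 (AB _ _) = s≤s z≤n
split<4 (BB _ _) = s≤s (s≤s (s≤s z≤n))

split : ∀ q r → ∃[ ρ ] ∃[ t ] ∃[ j ] (Split ρ t j q r ⊎ Split ρ t j r q)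
split (E k) (E l) = _ , _ , _ , inj₁ (EE k l)
split (E k) T     = _ , _ , _ , inj₁ (ET k)
split (E k) (A α) = _ , _ , _ , inj₁ (EA k α)
split (E k) (B β) = _ , _ , _ , inj₁ (EB k β)
split T (E k)     = _ , _ , _ , inj₂ (ET k)
split T T         = _ , _ , _ , inj₁ TT
split T (A α)     = _ , _ , _ , inj₁ (TA α)
split T (B β)     = _ , _ , _ , inj₁ (TB β)
split (A α) (E k) = _ , _ , _ , inj₂ (EA k α)
split (A α) T     = _ , _ , _ , inj₂ (TA α)
split (A α) (A β) = _ , _ , _ , inj₁ (AA α β)
split (A α) (B β) = _ , _ , _ , inj₁ (AB α β)
split (B β) (E k) = _ , _ , _ , inj₂ (EB k β)
split (B β) T     = _ , _ , _ , inj₂ (TB β)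
split (B β) (A α) = _ , _ , _ , inj₂ (AB α β)
split (B α) (B β) = _ , _ , _ , inj₁ (BB α β)

residue-unique : ∀ {ρ σ} s t → ρ < 4 → σ < 4 → ρ + s * 4 ≡ σ + t * 4 → ρ ≡ σ × s ≡ t
residue-unique {ρ} {σ} s t ρ<4 σ<4 p = ρ≡σ , *-cancelʳ-≡ s t 4
    (+-cancelˡ-≡ ρ _ _ (trans p (cong (_+ t * 4) (sym ρ≡σ))))
  where
  ρ≡σ : ρ ≡ σ
  ρ≡σ = begin
    ρ               ≡⟨ m<n⇒m%n≡m ρ<4 ⟨
    ρ % 4           ≡⟨ [m+kn]%n≡m%n ρ s 4 ⟨
    (ρ + s * 4) % 4 ≡⟨ cong (_% 4) p ⟩
    (σ + t * 4) % 4 ≡⟨ [m+kn]%n≡m%n σ t 4 ⟩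
    σ % 4           ≡⟨ m<n⇒m%n≡m σ<4 ⟩
    σ               ∎
    where open ≡-Reasoning

-- Sums of two points

PointAt : ℕ → ℕ → Set
PointAt i j = ∃[ p ] At p i j

Outcome : ℕ → ℕ → Set
Outcome i j = (i ≡ 0 × j ≡ 2) ⊎ PointAt i j ⊎ Two i j

outcome₂ : ∀ t j → Outcome (2 + t * 4) j
outcome₂ t j with class₂ t j
... | inj₁ (refl , refl) = inj₂ (inj₁ (T , refl , refl))
... | inj₂ w = inj₂ (inj₂ w)

outcome₀ : ∀ t j → Outcome (4 + t * 4) j
outcome₀ t j with class₀ t j
... | inj₁ refl = inj₂ (inj₁ (E (suc t) , refl , refl))
... | inj₂ w = inj₂ (inj₂ w)

outcomeA : ∀ t j → Outcome (1 + t * 4) j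
outcomeA t j with classA t j
... | inj₁ α = inj₂ (inj₁ (A α , refl , refl))
... | inj₂ w = inj₂ (inj₂ w)

-- The hypothesis holds when the sum is T + A or E + B; otherwise there may be no sum at all.
outcomeB : ∀ t j → InA t j ⊎ Odd j → Outcome (3 + t * 4) j
outcomeB t j src with classB t j
... | inj₁ β = inj₂ (inj₁ (B β , refl , refl))
... | inj₂ (inj₁ w) = inj₂ (inj₂ w)
outcomeB t j (inj₁ α) | inj₂ (inj₂ (_ , ∉A)) = contradiction α ∉A
outcomeB t j (inj₂ o) | inj₂ (inj₂ (e , _)) = contradiction o (even∧odd e)

split-outcome : ∀ {ρ t j q r} → Split ρ t j q r → Outcome (ρ + t * 4) j
split-outcome (EE zero zero)    = inj₁ (refl , refl)
split-outcome (EE zero (suc l)) = outcome₀ l 2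
split-outcome (EE (suc k) l)    = outcome₀ (k + l) 2
split-outcome (ET k)            = outcome₂ k 1
split-outcome TT                = outcome₀ 0 0
split-outcome (EA k {s} α)      = outcomeA (k + s) _
-- B columns are even, and the E point adds 1.
split-outcome (EB k {s} β)      = outcomeB (k + s) _ (inj₂ (suc (B⇒even β)))
split-outcome (TA {s} α)        = outcomeB s _ (inj₁ α)
split-outcome (TB {s} β)        = outcomeA (suc s) _
split-outcome (AA {s} {_} {t} _ _) = outcome₂ (s + t) _
split-outcome (AB {s} {_} {t} _ _) = outcome₀ (s + t) _
split-outcome (BB {s} {_} {t} _ _) = outcome₂ (suc (s + t)) _

sum-outcome : ∀ q r → Outcome (row q + row r) (col q + col r)
sum-outcome q r with split q r
... | ρ , t , j , inj₁ s = subst₂ Outcome (sym (split-row s)) (sym (split-col s)) (split-outcome s)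
... | ρ , t , j , inj₂ s = subst₂ Outcome
  (sym (trans (+-comm (row q) _) (split-row s)))
  (sym (trans (+-comm (col q) _) (split-col s))) (split-outcome s)

-- Uniqueness of unordered representations: a fixed summand occurs in all of them.
record Single (i j : ℕ) : Set where
  field
    some : Rep i j
    unavoidable : ∀ q r → row q + row r ≡ i → col q + col r ≡ j →
           SameAs q (left some) ⊎ SameAs r (left some)
open Single public

OneRep : (ρ t j : ℕ) → Point → Set
OneRep ρ t j c = ∀ {q r} → Split ρ t j q r → SameAs q c ⊎ SameAs r c

-- The coordinates of a sum fix the indices of `Split`, by division with remainder, so uniqueness
-- need only be checked on the ordered forms with those indices.
mkSingle : ∀ {ρ t j} → ρ < 4 → (w : Rep (ρ + t * 4) j) → OneRep ρ t j (left w) → Single (ρ + t * 4) j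
mkSingle {t = t} ρ<4 w one = record { some = w ; unavoidable = λ q r → go q r }
  where
  go : ∀ q r → row q + row r ≡ _ → col q + col r ≡ _ → SameAs q (left w) ⊎ SameAs r (left w)
  go q r p p′ with split q r
  ... | _ , t′ , _ , inj₁ s
      with refl ← trans (sym (split-col s)) p′
      with refl , refl ← residue-unique t′ t (split<4 s) ρ<4 (trans (sym (split-row s)) p) = one s
  ... | _ , t′ , _ , inj₂ s
      with refl ← trans (sym (split-col s)) (trans (+-comm (col r) _) p′)
      with refl , refl ← residue-unique t′ t (split<4 s) ρ<4
             (trans (sym (split-row s)) (trans (+-comm (row r) _) p)) = swap (one s)

-- One representation for each point other than the generators

IsStart : Point → Set
IsStart p = At p 0 1 ⊎ At p 1 0

-- Only A + B fits. B columns are even, so the A summand is in column 1, which A points occupy only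
-- in row 1.
oneE : ∀ {t} → OneRep 0 (suc t) 1 (A {0} {1} full)
oneE s = go s refl
  where
  go : ∀ {t j q r} → Split 0 t j q r → j ≡ 1 → SameAs q (A {0} {1} full) ⊎ SameAs r (A {0} {1} full)
  go (AB {j = 0} α β) refl with suc () ← B⇒even β
  go (AB {j = 1} full β) p = inj₁ (refl , refl)

oneT : OneRep 2 0 0 (A {0} {0} full)
oneT s = go s refl refl
  where
  go : ∀ {t j q r} → Split 2 t j q r → t ≡ 0 → j ≡ 0 →
    SameAs q (A {0} {0} full) ⊎ SameAs r (A {0} {0} full)
  go (AA {s = 0} {j = 0} α β) refl refl = inj₁ (refl , refl)

-- E + B would lie in an odd column, which leaves `T` plus an A point.
oneB : ∀ {t j} → Even j → OneRep 3 t j T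
oneB (suc o) (EB k β) = contradiction o (even∧odd (B⇒even β))
oneB e (TA α) = inj₁ (refl , refl)

oneA₀ : ∀ {j} → OneRep 1 0 j (E 0)
oneA₀ s = go s refl
  where
  go : ∀ {t j q r} → Split 1 t j q r → t ≡ 0 → SameAs q (E 0) ⊎ SameAs r (E 0)
  go (EA 0 α) p = inj₁ (refl , refl)

oneA-base : ∀ {t} → OneRep 1 t 0 T
oneA-base (TB β) = inj₁ (refl , refl)

-- E + A needs an A point in column 1, found only in row 1. T + B needs a point in column 2 two rows
-- lower, which the parity of `t` rules out.
oneA-two : ∀ {t} → Even t → OneRep 1 (2 + t) 2 (E (2 + t))
oneA-two {t} e s = go s refl refl
  where
  go : ∀ {u j q r} → Split 1 u j q r → u ≡ 2 + t → j ≡ 2 → SameAs q (E (2 + t)) ⊎ SameAs r (E (2 + t))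
  go (EA k full) p refl = inj₁ (cong (_* 4) (trans (sym (+-identityʳ k)) p) , refl)
  go (TB (two e′)) refl refl = contradiction e λ { (suc o) → even∧odd e′ o }

-- T + B has an even column, so the sum is E + A, and the hypothesis puts the A point in row 1. The
-- bound on `s` serves `five`: column 2 is occupied again in row 9, but not in row 5.
oneA-odd : ∀ {t j} → Even j → (∀ {s} → s ≤ suc t → InA s j → s ≡ 0) →
  OneRep 1 (suc t) (suc j) (E (suc t))
oneA-odd {t} {j} e only-full s = go s refl refl
  where
  go : ∀ {u l q r} → Split 1 u l q r → u ≡ suc t → l ≡ suc j →
    SameAs q (E (suc t)) ⊎ SameAs r (E (suc t))
  go (EA k {s} α) p refl with refl ← only-full (subst (s ≤_) p (m≤n+m s k)) α =
    inj₁ (cong (_* 4) (trans (sym (+-identityʳ k)) p) , refl)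
  go (TB β) p refl = contradiction (suc e) (even∧odd (B⇒even β))

even-tail : ∀ {t j} → Even j → InA t (4 + j) → t ≡ 0
even-tail e full = refl
even-tail e (tail o) = contradiction o (even∧odd e)

single : ∀ p → IsStart p ⊎ Single (row p) (col p)
single (E zero)    = inj₁ (inj₁ (refl , refl))
single (E (suc t)) = inj₂ (mkSingle {t = suc t} (s≤s z≤n)
  (rep (A {0} {1} full) (B {t} base) refl refl) oneE)
single T           = inj₂ (mkSingle {t = 0} (s≤s (s≤s (s≤s z≤n)))
  (rep (A {0} {0} full) (A {0} {0} full) refl refl) oneT)
single (A {0} {zero} full)  = inj₁ (inj₂ (refl , refl))
single (A {0} {suc j} full) = inj₂ (mkSingle {t = 0} (s≤s (s≤s z≤n))
  (rep (E 0) (A {0} {j} full) refl refl) oneA₀)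
-- The generator (1 , 0) again, now with the proof `base`.
single (A {0} base)      = inj₁ (inj₂ (refl , refl))
single (A {suc t} base)  = inj₂ (mkSingle {t = suc t} (s≤s (s≤s z≤n))
  (rep T (B {t} base) refl refl) oneA-base)
single (A five) = inj₂ (mkSingle {t = 1} (s≤s (s≤s z≤n))
  (rep (E 1) (A {0} {2} full) refl refl)
  (oneA-odd (suc (suc zero)) λ { _ full → refl ; (s≤s ()) (two _) }))
single (A (two {t} e)) = inj₂ (mkSingle {t = 2 + t} (s≤s (s≤s z≤n))
  (rep (E (2 + t)) (A {0} {1} full) (+-comm ((2 + t) * 4) 1) refl) (oneA-two e))
single (A (tail {t} (suc {j} e))) = inj₂ (mkSingle {t = suc t} (s≤s (s≤s z≤n))
  (rep (E (suc t)) (A {0} {4 + j} full) (+-comm (suc t * 4) 1) refl)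
  (oneA-odd {t} (suc (suc (suc (suc e)))) λ _ → even-tail e))
single (B {t} {j} β) = inj₂ (mkSingle {t = t} (s≤s (s≤s (s≤s (s≤s z≤n))))
  (rep T (A (B⇒A β)) refl refl) (oneB (B⇒even β)))

-- The terms up to a b + a

V-reaches : ∀ {a b x} m → x ∈ terms a b m → ∃[ i ] i < 2 + m × V a b i ≡ x
V-reaches zero (here refl) = 1 , ≤-refl , refl
V-reaches zero (there (here refl)) = 0 , s≤s z≤n , refl
V-reaches (suc m) (here refl) = suc (suc m) , ≤-refl , refl
V-reaches (suc m) (there x∈) = let i , i< , p = V-reaches m x∈ in i , m<n⇒m<1+n i< , p

-- Sending `i` to the index of `f i` in `xs` is injective.
injection⇒≤length : ∀ {n} {xs : List ℕ} (f : Fin n → ℕ) →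
  (∀ {i j} → f i ≡ f j → i ≡ j) → (∀ i → f i ∈ xs) → n ≤ length xs
injection⇒≤length {xs = xs} f f-injective f∈ = injective⇒≤ λ {i} {j} p →
  f-injective (trans (lookup-index (f∈ i)) (trans (cong (lookup xs) p) (sym (lookup-index (f∈ j)))))

module Values (a b : ℕ) (0<a : 0 < a) (coprime : Coprime a b) (2a<b : 2 * a < b) where

  instance
    a≢0 : NonZero a
    a≢0 = >-nonZero 0<a

  a<b : a < b
  a<b = ≤-<-trans (m≤m+n a (a + 0)) 2a<b

  2<b : 2 < b
  2<b = ≤-<-trans (*-monoʳ-≤ 2 0<a) 2a<b

  0<b : 0 < b
  0<b = <-trans 0<a a<b

  eval : ℕ → ℕ → ℕ
  eval i j = i * b + j * a

  value : Point → ℕ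
  value p = eval (row p) (col p)

  -- Large enough for every 4 k b + a with 4 k ≤ a, yet below (a + 1) b, so that only rows up to `a`
  -- occur.
  bound : ℕ
  bound = a * b + a

  row≤a : ∀ i j → eval i j ≤ bound → i ≤ a
  row≤a i j ≤bound with i ≤? a
  ... | yes p = p
  ... | no ≰a = contradiction ≤bound (<⇒≱ (begin-strict
    a * b + a ≡⟨ +-comm (a * b) a ⟩
    a + a * b <⟨ +-monoˡ-< (a * b) a<b ⟩
    suc a * b ≤⟨ *-monoˡ-≤ b (≰⇒> ≰a) ⟩
    i * b     ≤⟨ m≤m+n (i * b) (j * a) ⟩
    eval i j  ∎))
    where open ≤-Reasoning

  -- The only coincidence in rows 0 … a is a b = b a, which would need b columns in row 0.
  eval-injective-≤ : ∀ {i j i′ j′} → i ≤ i′ → i′ ≤ a → (i ≡ 0 → j < b) →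
    eval i j ≡ eval i′ j′ → i ≡ i′ × j ≡ j′
  eval-injective-≤ {i} {j} {i′} {j′} i≤i′ i′≤a small eq = go (i′ ∸ i) refl
    where
    ja≡ : ∀ d → i + d ≡ i′ → j * a ≡ d * b + j′ * a
    ja≡ d refl = +-cancelˡ-≡ (i * b) _ _ (trans eq (lemma i d b (j′ * a)))
      where lemma : ∀ i d b c → (i + d) * b + c ≡ i * b + (d * b + c)
            lemma = solve-∀
    go : ∀ d → i′ ∸ i ≡ d → i ≡ i′ × j ≡ j′
    go zero p = i≡i′ , *-cancelʳ-≡ j j′ a (ja≡ 0 (trans (+-identityʳ i) i≡i′))
      where i≡i′ = ≤-antisym i≤i′ (m∸n≡0⇒m≤n p)
    -- Here a divides (d + 1) b, hence d + 1; so the rows are 0 and a, and j ≥ b follows.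
    go (suc d) p = contradiction (small i≡0) (≤⇒≯ (*-cancelʳ-≤ b j a (begin
      b * a              ≡⟨ *-comm b a ⟩
      a * b              ≤⟨ *-monoˡ-≤ b a≤d ⟩
      suc d * b          ≤⟨ m≤m+n (suc d * b) (j′ * a) ⟩
      suc d * b + j′ * a ≡⟨ ja≡ (suc d) i+d≡i′ ⟨
      j * a              ∎)))
      where
      open ≤-Reasoning
      i+d≡i′ : i + suc d ≡ i′
      i+d≡i′ = trans (cong (i +_) (sym p)) (m+[n∸m]≡n i≤i′)
      a∣db : a ∣ b * suc d
      a∣db = subst (a ∣_) (*-comm (suc d) b)
        (∣m+n∣m⇒∣n (subst (a ∣_) (trans (ja≡ (suc d) i+d≡i′) (+-comm _ (j′ * a))) (n∣m*n j)) (n∣m*n j′))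
      a≤d : a ≤ suc d
      a≤d = ∣⇒≤ (coprime-divisor coprime a∣db)
      i≡0 : i ≡ 0
      i≡0 = n≤0⇒n≡0 (+-cancelʳ-≤ (suc d) i 0 (≤-trans (≤-reflexive i+d≡i′) (≤-trans i′≤a a≤d)))

  eval-injective : ∀ {i j i′ j′} → i ≤ a → i′ ≤ a → (i ≡ 0 → j < b) → (i′ ≡ 0 → j′ < b) →
    eval i j ≡ eval i′ j′ → i ≡ i′ × j ≡ j′
  eval-injective {i} {j} {i′} {j′} i≤a i′≤a small small′ eq with ≤-total i i′
  ... | inj₁ i≤i′ = eval-injective-≤ i≤i′ i′≤a small eq
  ... | inj₂ i′≤i = let p , q = eval-injective-≤ i′≤i i≤a small′ (sym eq) in sym p , sym q

  col-small : ∀ p → row p ≡ 0 → col p < 2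
  col-small (E zero) _ = s≤s (s≤s z≤n)

  -- Row 0 holds only `E 0`, so the only sum there has column 2. This is the side condition of
  -- `eval-injective` for sums.
  col-sum-small : ∀ q r → row q + row r ≡ 0 → col q + col r < b
  col-sum-small (E zero) (E zero) _ = 2<b

  value-injective : ∀ p q → value p ≤ bound → value p ≡ value q → SameAs p q
  value-injective p q ≤bound eq = eval-injective (row≤a (row p) (col p) ≤bound)
    (row≤a (row q) (col q) (subst (_≤ bound) eq ≤bound))
    (λ z → <-trans (col-small p z) 2<b) (λ z → <-trans (col-small q z) 2<b) eq

  value-cong : ∀ p q → SameAs p q → value p ≡ value q
  value-cong _ _ (i≡ , j≡) = cong₂ eval i≡ j≡

  value-+ : ∀ q r → value q + value r ≡ eval (row q + row r) (col q + col r)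
  value-+ q r = lemma (row q) (row r) (col q) (col r) a b
    where
    lemma : ∀ i i′ j j′ a b → i * b + j * a + (i′ * b + j′ * a) ≡ (i + i′) * b + (j + j′) * a
    lemma = solve-∀

  value-positive : ∀ p → 0 < value p
  value-positive (E k) = <-≤-trans 0<a (≤-trans (m≤m+n a 0) (m≤n+m _ (k * 4 * b)))
  value-positive T     = <-≤-trans 0<b (≤-trans (m≤m+n b _) (m≤m+n _ 0))
  value-positive (A α) = <-≤-trans 0<b (≤-trans (m≤m+n b _) (m≤m+n _ _))
  value-positive (B β) = <-≤-trans 0<b (≤-trans (m≤m+n b _) (m≤m+n _ _))

  Value : ℕ → Set
  Value n = ∃[ p ] value p ≡ n

  value-a : Value a
  value-a = E 0 , +-identityʳ a

  value-b : Value b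
  value-b = A {0} {0} full , trans (+-identityʳ _) (+-identityʳ b)

  values≤b : ∀ p → value p ≤ b → value p ≡ a ⊎ value p ≡ b
  values≤b (E zero) _ = inj₁ (+-identityʳ a)
  values≤b (A {zero} {zero} _) _ = inj₂ (trans (+-identityʳ _) (+-identityʳ b))
  values≤b (A {zero} {suc j} _) v≤b = contradiction v≤b (<⇒≱ (begin-strict
    b                     <⟨ m<m+n b 0<a ⟩
    b + a                 ≤⟨ +-mono-≤ (m≤m+n b 0) (m≤m+n a (j * a)) ⟩
    b + 0 + (a + j * a)   ∎))
    where open ≤-Reasoning
  values≤b (E (suc k)) v≤b = contradiction v≤b (<⇒≱ (<-≤-trans
    (m<m+n b (<-≤-trans 0<b (m≤m+n b _))) (m≤m+n _ _)))
  values≤b T v≤b = contradiction v≤b (<⇒≱ (<-≤-trans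
    (m<m+n b (<-≤-trans 0<b (m≤m+n b _))) (m≤m+n _ _)))
  values≤b (A {suc t} _) v≤b = contradiction v≤b (<⇒≱ (<-≤-trans
    (m<m+n b (<-≤-trans 0<b (m≤m+n b _))) (m≤m+n _ _)))
  values≤b (B _) v≤b = contradiction v≤b (<⇒≱ (<-≤-trans
    (m<m+n b (<-≤-trans 0<b (m≤m+n b _))) (m≤m+n _ _)))

  -- From lattice points to the greedy sequence

  record TwoSums (n : ℕ) : Set where
    field
      {x y x′ y′} : ℕ
      vx : Value x
      vy : Value y
      vx′ : Value x′
      vy′ : Value y′
      sum  : x + y ≡ n
      sum′ : x′ + y′ ≡ n
      x≢x′ : x ≢ x′
      x≢y′ : x ≢ y′

  record OneSum (n : ℕ) : Set where
    field
      {c d} : ℕ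
      vc : Value c
      vd : Value d
      sum : c + d ≡ n
      only : ∀ {x y} → Value x → Value y → x + y ≡ n → x ≡ c ⊎ y ≡ c

  rep-value : ∀ {i j} (w : Rep i j) → value (left w) + value (right w) ≡ eval i j
  rep-value (rep q r p p′) = trans (value-+ q r) (cong₂ eval p p′)

  sum-of-values : ∀ {n x y} → b < n → n ≤ bound → Value x → Value y → x + y ≡ n →
    Value n ⊎ TwoSums n
  sum-of-values b<n n≤bound (q , refl) (r , refl) refl
    with ev ← value-+ q r | sum-outcome q r
  -- The exceptional sum `E 0` plus `E 0` has value 2 a, below b and so below `n`.
  ... | inj₁ (i≡0 , j≡2) = contradiction (trans ev (cong₂ eval i≡0 j≡2))
          (>⇒≢ (<-trans 2a<b b<n))
  ... | inj₂ (inj₁ (p , i≡ , j≡)) = inj₁ (p , trans (cong₂ eval i≡ j≡) (sym ev))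
  ... | inj₂ (inj₂ (twice w w′ ≢left ≢right)) = inj₂ record
    { vx = left w , refl ; vy = right w , refl ; vx′ = left w′ , refl ; vy′ = right w′ , refl
    ; sum = sum ; sum′ = trans (rep-value w′) (sym ev)
    ; x≢x′ = λ e → ≢left (value-injective (left w) (left w′) ≤bound e)
    ; x≢y′ = λ e → ≢right (value-injective (left w) (right w′) ≤bound e) }
    where
    sum = trans (rep-value w) (sym ev)
    ≤bound : value (left w) ≤ bound
    -- A summand of `n` stays within `bound`, where distinct positions of points have distinct
    -- values.
    ≤bound = ≤-trans (m≤m+n _ _) (≤-trans (≤-reflexive sum) n≤bound)

  value-single : ∀ {n} → b < n → n ≤ bound → Value n → OneSum n
  value-single b<n n≤bound (p , refl) with single p
  ... | inj₁ (inj₁ g) = contradiction (trans (value-cong p (E 0) g) (+-identityʳ a))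
          (>⇒≢ (<-trans a<b b<n))
  ... | inj₁ (inj₂ g) = contradiction
          (trans (value-cong p (A {0} {0} full) g) (proj₂ value-b)) (>⇒≢ b<n)
  ... | inj₂ s = record
    { vc = left (some s) , refl ; vd = right (some s) , refl ; sum = rep-value (some s)
    ; only = λ { (q , refl) (r , refl) e → convert q r (trans (sym (value-+ q r)) e) } }
    where
    convert : ∀ q r → eval (row q + row r) (col q + col r) ≡ value p →
      value q ≡ value (left (some s)) ⊎ value r ≡ value (left (some s))
    convert q r e
      -- Both sides evaluate to `n`, within `bound`, so their coordinates agree and `unavoidable`
      -- applies.
      with i≡ , j≡ ← eval-injective
             (row≤a (row q + row r) (col q + col r) (≤-trans (≤-reflexive e) n≤bound))
             (row≤a (row p) (col p) n≤bound)
             (col-sum-small q r) (λ z → <-trans (col-small p z) 2<b) e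
      with unavoidable s q r i≡ j≡
    ... | inj₁ same = inj₁ (value-cong q (left (some s)) same)
    ... | inj₂ same = inj₂ (value-cong r (left (some s)) same)

  -- The invariant once all numbers up to `n` are decided: the terms so far are the values up to
  -- `n`, and by `gap` the search for the next term passes over the rest of that range.
  record Stage (n : ℕ) : Set where
    field
      m        : ℕ
      sound    : ∀ {x} → x ∈ terms a b m → Value x × x ≤ headOr0 (terms a b m)
      complete : ∀ {x} → Value x → x ≤ n → x ∈ terms a b m
      distinct : Unique (terms a b m)
      head≤n   : headOr0 (terms a b m) ≤ n
      gap      : ∀ {k} → headOr0 (terms a b m) < k → k ≤ n → reps (terms a b m) k ≢ 1
  open Stage

  initial : Stage b
  initial .m = 0
  initial .sound (here refl) = value-b , ≤-refl
  initial .sound (there (here refl)) = value-a , <⇒≤ a<b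
  initial .complete (p , refl) v≤b with values≤b p v≤b
  ... | inj₁ e = there (here e)
  ... | inj₂ e = here e
  initial .distinct = (>⇒≢ a<b ∷ []) ∷ [] ∷ []
  initial .head≤n = ≤-refl
  initial .gap b<k k≤b = contradiction k≤b (<⇒≱ b<k)

  module Step {n} (b≤n : b ≤ n) (n<bound : n < bound) (st : Stage n) where

    xs : List ℕ
    xs = terms a b (m st)

    summand≤n : ∀ {x y} → Value y → x + y ≡ suc n → x ≤ n
    summand≤n {x} (p , refl) e = ≤-pred (subst (x <_) e (m<m+n x (value-positive p)))

    summand∈ : ∀ {x y} → Value x → Value y → x + y ≡ suc n → x ∈ xs × y ∈ xs
    summand∈ {x} {y} vx vy e = complete st vx (summand≤n vy e) ,
      complete st vy (summand≤n vx (trans (+-comm y x) e))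

    -- The summands from `OneSum` are at most `n`, as values are positive, and so are listed
    -- already; its common summand `c` is what `reps≤1` asks for.
    value⇒reps≡1 : Value (suc n) → reps xs (suc n) ≡ 1
    value⇒reps≡1 v = ≤-antisym
      (reps≤1 (distinct st) c λ x∈ y∈ → only (proj₁ (sound st x∈)) (proj₁ (sound st y∈)))
      (reps-positive (proj₁ c,d∈) (proj₂ c,d∈) sum)
      where
      open OneSum (value-single (s≤s b≤n) n<bound v)
      c,d∈ = summand∈ vc vd sum

    -- A sum of two terms is a value or has two representations by values. In the latter case all
    -- four summands are listed already, and the count would reach 2.
    reps≡1⇒value : reps xs (suc n) ≡ 1 → Value (suc n)
    reps≡1⇒value one
      with x , y , x∈ , y∈ , e ← reps-witness xs (suc n) (λ z → contradiction (trans (sym z) one) λ ())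
      with sum-of-values (s≤s b≤n) n<bound (proj₁ (sound st x∈)) (proj₁ (sound st y∈)) e
    ... | inj₁ v = v
    ... | inj₂ w = contradiction (subst (2 ≤_) one (reps-two
            (proj₁ xy∈) (proj₂ xy∈) (proj₁ xy′∈) (proj₂ xy′∈) sum sum′ x≢x′ x≢y′)) λ { (s≤s ()) }
      where
      open TwoSums w
      xy∈ = summand∈ vx vy sum
      xy′∈ = summand∈ vx′ vy′ sum′

    next≡ : reps xs (suc n) ≡ 1 → next xs ≡ suc n
    next≡ one = search-least (suc (headOr0 xs)) (headOr0 xs) (s≤s (head≤n st)) within
      (λ lo hi → gap st lo (≤-pred hi)) one
      where
      -- `suc n` is a sum of two terms, so at most twice the head, within reach of the fuel.
      within : suc n ≤ suc (headOr0 xs) + headOr0 xs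
      within with x , y , x∈ , y∈ , e ← reps-witness xs (suc n)
                   (λ z → contradiction (trans (sym z) one) λ ()) =
        ≤-trans (≤-reflexive (sym e))
          (≤-trans (+-mono-≤ (proj₂ (sound st x∈)) (proj₂ (sound st y∈))) (n≤1+n _))

    step : Stage (suc n)
    step with reps xs (suc n) ≟ 1
    -- `suc n` is then not a value, so the same list serves.
    ... | no ≢1 = record
      { m = m st ; sound = sound st ; distinct = distinct st ; head≤n = m≤n⇒m≤1+n (head≤n st)
      ; complete = complete′ ; gap = gap′ }
      where
      complete′ : ∀ {x} → Value x → x ≤ suc n → x ∈ xs
      complete′ v x≤ with m≤n⇒m<n∨m≡n x≤
      ... | inj₁ x<   = complete st v (≤-pred x<)
      ... | inj₂ refl = contradiction (value⇒reps≡1 v) ≢1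
      gap′ : ∀ {k} → headOr0 xs < k → k ≤ suc n → reps xs k ≢ 1
      gap′ lo k≤ with m≤n⇒m<n∨m≡n k≤
      ... | inj₁ k<   = gap st lo (≤-pred k<)
      ... | inj₂ refl = ≢1
    ... | yes one = record
      { m = suc (m st) ; sound = sound′ ; complete = complete′
      -- The new term exceeds the old head, which bounds all earlier terms.
      ; distinct = All.tabulate (λ x∈ e → <⇒≱ (s≤s (head≤n st))
          (≤-trans (≤-reflexive (trans (sym new) e)) (proj₂ (sound st x∈)))) ∷ distinct st
      ; head≤n = ≤-reflexive new
      ; gap = λ lo k≤ → contradiction k≤ (<⇒≱ (subst (_< _) new lo)) }
      where
      new : next xs ≡ suc n
      new = next≡ one
      sound′ : ∀ {x} → x ∈ next xs ∷ xs → Value x × x ≤ next xs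
      sound′ (here refl) = subst Value (sym new) (reps≡1⇒value one) , ≤-refl
      sound′ (there x∈) = let v , x≤ = sound st x∈ in
        v , ≤-trans x≤ (≤-trans (m≤n⇒m≤1+n (head≤n st)) (≤-reflexive (sym new)))
      complete′ : ∀ {x} → Value x → x ≤ suc n → x ∈ next xs ∷ xs
      complete′ v x≤ with m≤n⇒m<n∨m≡n x≤
      ... | inj₁ x<   = there (complete st v (≤-pred x<))
      ... | inj₂ refl = here (sym new)

  stage : ∀ d → b + d ≤ bound → Stage (b + d)
  stage zero    _ = subst Stage (sym (+-identityʳ b)) initial
  stage (suc d) ≤bound = subst Stage (sym (+-suc b d))
    (Step.step (m≤m+n b d) <bound (stage d (<⇒≤ <bound)))
    where <bound = subst (_≤ bound) (+-suc b d) ≤bound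

  b≤bound : b ≤ bound
  b≤bound = ≤-trans (≤-trans (≤-reflexive (sym (*-identityˡ b))) (*-monoˡ-≤ b 0<a)) (m≤m+n _ a)

  final : Stage bound
  final = subst Stage (m+[n∸m]≡n b≤bound)
    (stage (bound ∸ b) (≤-reflexive (m+[n∸m]≡n b≤bound)))

  -- The even terms

  evenPoint : Fin (2 + a / 4) → Point
  evenPoint zero    = T
  evenPoint (suc k) = E (toℕ k)

  module _ (2∣a : 2 ∣ a) where

    2≤a : 2 ≤ a
    2≤a = ∣⇒≤ 2∣a

    evenPoint≤bound : ∀ i → value (evenPoint i) ≤ bound
    evenPoint≤bound zero = +-mono-≤ (*-monoˡ-≤ b 2≤a) z≤n
    evenPoint≤bound (suc k) = +-mono-≤
      -- The index is at most a / 4, so the row is at most a.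
      (*-monoˡ-≤ b (≤-trans (*-monoˡ-≤ 4 (≤-pred (toℕ<n k))) (m/n*n≤m a 4)))
      (≤-reflexive (+-identityʳ a))

    evenPoint-injective : ∀ {i j} → value (evenPoint i) ≡ value (evenPoint j) → i ≡ j
    evenPoint-injective {i} {j} e = go i j
        (value-injective (evenPoint i) (evenPoint j) (evenPoint≤bound i) e)
      where
      go : ∀ i j → SameAs (evenPoint i) (evenPoint j) → i ≡ j
      go zero zero _ = refl
      go (suc k) (suc l) (p , _) = cong suc (toℕ-injective (*-cancelʳ-≡ (toℕ k) (toℕ l) 4 p))

    evenPoint-even : ∀ i → 2 ∣ value (evenPoint i)
    evenPoint-even zero    = ∣m∣n⇒∣m+n (m∣m*n b) (2 ∣0)
    evenPoint-even (suc k) = ∣m∣n⇒∣m+n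
      (∣m⇒∣m*n b (∣n⇒∣m*n (toℕ k) (divides 2 refl))) (∣n⇒∣m*n 1 2∣a)

    evenCount-bound : ∃[ N ] 2 + a / 4 ≤ evenCount a b N
    -- The list `terms a b m` consists of the first 2 + m terms.
    evenCount-bound = 2 + m final , injection⇒≤length (λ i → value (evenPoint i)) evenPoint-injective λ i →
      let k , k< , p = V-reaches (m final)
                         (complete final (evenPoint i , refl) (evenPoint≤bound i))
      in ∈-filter⁺ (2 ∣?_) (subst (_∈ map (V a b) (upTo (2 + m final))) p (∈-map⁺ (V a b) (∈-upTo⁺ k<)))
           (evenPoint-even i)

theorem1p4 : ∀ (a b : ℕ) → 0 < a → Coprime a b → 2 ∣ a → 2 * a < b →
    ∃[ N ] 2 + a / 4 ≤ evenCount a b N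
theorem1p4 a b 0<a coprime 2∣a 2a<b = Values.evenCount-bound a b 0<a coprime 2a<b 2∣a
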